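{- For every $\varepsilon>0$ there exists $c(\varepsilon)>0$ with the following property. Let $a_{1}< \ldots < a_{n}$ be $n$ natural numbers. Then $$\sum_{1\leq i<j\leq n}\frac{\gcd(a_{i},a_{j})}{a_{j}}< c(\varepsilon)\,n^{1+\varepsilon}.$$ -}

module Defs where

open import Data.Nat using (ℕ; zero; suc)
open import Data.Nat.GCD using (gcd)
open import Data.Fin using (Fin)
open import Data.Fin.Properties using (_<?_)
open import Data.List using (List; map; filter; foldr; allFin)
open import Data.Integer using (+_)
open import Data.Rational using (ℚ; 0ℚ; 1ℚ; _+_; _*_; _/_)

-- x / y as a rational number; the (unused) case y = 0 is set to 0.
frac : ℕ → ℕ → ℚ
frac x zero    = 0ℚ
frac x (suc y) = (+ x) / suc y

sumℚ : List ℚ → ℚ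
sumℚ = foldr _+_ 0ℚ

_^ℚ_ : ℚ → ℕ → ℚ
x ^ℚ zero  = 1ℚ
x ^ℚ suc k = x * (x ^ℚ k)

gcdSum : (n : ℕ) → (Fin n → ℕ) → ℚ
gcdSum n a =
  sumℚ (map (λ j → sumℚ (map (λ i → frac (gcd (a i) (a j)) (a j))
                              (filter (λ i → i <? j) (allFin n))))
            (allFin n))

{-# OPTIONS --safe #-}
-- For i < j write a_i = g u and a_j = g v with g = gcd(a_i, a_j). The number W i j of pairs
-- (x, y) ∈ [1, n]² with a_i y = a_j x is ⌊n / v⌋, so n gcd(a_i, a_j) / a_j ≤ 1 + W i j, and it
-- suffices to bound the multiplicative energy E = ∑ᵢⱼ W i j by n^(2 + ε). The matrix W is
-- symmetric, so iterating Cauchy–Schwarz gives E^k ≤ n^(k-1) ∑ᵢⱼ (W^k) i j for k = 2^m. As the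
-- a_i are distinct, (W^k) i j counts at most the X, Y ∈ [1, n]^k with a_i ∏ Y = a_j ∏ X. Here X
-- is arbitrary, and given X the product M = ∏ Y ≤ n^k is determined, which leaves at most
-- d(M)^k ≤ C n choices of Y by the divisor bound d(M)^(k²) ≤ C M. Hence E^k ≤ C n^(2k + 2).
module Submission where

open import Defs
open import Data.Nat using (ℕ; _≤_; _+_; _^_)
open import Data.Fin using (Fin)
open import Data.Product using (∃; _×_)
import Data.Fin as F
import Data.Nat as N

open import Algebra.Bundles using (CommutativeMonoid)
import Data.Fin.Properties as F
import Data.Integer as ℤ
import Data.Integer.Properties as ℤ
open import Data.List using (List; []; _∷_; _++_; map; length; filter; allFin; applyDownFrom; cartesianProductWith)
open import Data.List.Membership.Propositional using (_∈_; find)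
open import Data.List.Membership.Propositional.Properties
  using (∈-applyDownFrom⁺; ∈-applyDownFrom⁻; ∈-cartesianProductWith⁻; ∈-allFin; ∈-filter⁻)
open import Data.List.Properties using (length-applyDownFrom; length-tabulate)
open import Data.List.Relation.Unary.All as All using (All; []; _∷_)
open import Data.List.Relation.Unary.AllPairs using ([]; _∷_)
open import Data.List.Relation.Unary.Any as Any using (here; there; any?)
open import Data.List.Relation.Unary.Unique.Propositional using (Unique)
open import Data.List.Relation.Unary.Unique.Propositional.Properties using (applyDownFrom⁺₁; allFin⁺)
open import Data.Nat using (zero; suc; z≤n; s≤s; _≟_; _<?_; _⊓_; _⊔_; _%_; NonZero; >-nonZero; nonTrivial⇒n>1)
open import Data.Nat.Coprimality using (Coprime; coprime-divisor)
open import Data.Nat.Divisibility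
open import Data.Nat.DivMod using (m≡m%n+[m/n]*n; m%n<n; m/n*n≤m)
open import Data.Nat.GCD using (gcd; gcd[m,n]∣m; gcd[m,n]∣n)
open import Data.Nat.Induction using (<-rec)
open import Data.Nat.ListAction using (product)
open import Data.Nat.Primality using (Prime; prime?; prime⇒nonZero; prime⇒nonTrivial; prime⇒irreducible)
open import Data.Nat.Primality.Factorisation using (factorise; module PrimeFactorisation)
open import Data.Nat.Properties hiding (_≟_; _<?_)
open import Data.Nat.Tactic.RingSolver using (solve-∀)
open import Data.Product using (∃₂; _,_; proj₁; proj₂)
open import Data.Rational as ℚ using (ℚ; 0ℚ; toℚᵘ)
import Data.Rational.Properties as ℚ
import Data.Rational.Unnormalised as ℚᵘ
import Data.Rational.Unnormalised.Properties as ℚᵘ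
open import Data.Sum using (inj₁; inj₂)
open import Function using (_∘_; id)
open import Relation.Binary.Definitions using (tri<; tri≈; tri>)
open import Relation.Binary.PropositionalEquality
open import Relation.Nullary using (¬_; Dec; yes; no; contradiction)
open import Relation.Unary using (Decidable)

-- Finite sums of natural numbers, indicators and Cauchy-Schwarz.

module FiniteSums where
  open import Data.Nat using (_*_; _<_)
  open ≤-Reasoning

  private variable
    A B C P Q : Set

  𝟙 : Dec P → ℕ
  𝟙 (yes _) = 1
  𝟙 (no _)  = 0

  𝟙≤1 : (d : Dec P) → 𝟙 d ≤ 1
  𝟙≤1 (yes _) = ≤-refl
  𝟙≤1 (no _)  = z≤n

  𝟙-true : (d : Dec P) → P → 𝟙 d ≡ 1
  𝟙-true (yes _) _ = refl
  𝟙-true (no ¬p) p = contradiction p ¬p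

  𝟙-≤ : (d : Dec P) {k : ℕ} → (P → 1 ≤ k) → 𝟙 d ≤ k
  𝟙-≤ (yes p) h = h p
  𝟙-≤ (no _)  _ = z≤n

  𝟙-mono : (d : Dec P) (e : Dec Q) → (P → Q) → 𝟙 d ≤ 𝟙 e
  𝟙-mono d e h = 𝟙-≤ d λ p → ≤-reflexive (sym (𝟙-true e (h p)))

  𝟙*-≤ : (d : Dec P) {x y : ℕ} → (P → x ≤ y) → 𝟙 d * x ≤ y
  𝟙*-≤ (yes p) {x} h = ≤-trans (≤-reflexive (*-identityˡ x)) (h p)
  𝟙*-≤ (no _)  _ = z≤n

  ∑ : List A → (A → ℕ) → ℕ
  ∑ []       f = 0
  ∑ (x ∷ xs) f = f x + ∑ xs f

  ∑-mono : ∀ xs {f g : A → ℕ} → (∀ {x} → x ∈ xs → f x ≤ g x) → ∑ xs f ≤ ∑ xs g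
  ∑-mono []       h = z≤n
  ∑-mono (x ∷ xs) h = +-mono-≤ (h (here refl)) (∑-mono xs (h ∘ there))

  ∑-cong : ∀ xs {f g : A → ℕ} → (∀ x → f x ≡ g x) → ∑ xs f ≡ ∑ xs g
  ∑-cong []       h = refl
  ∑-cong (x ∷ xs) h = cong₂ _+_ (h x) (∑-cong xs h)

  ∑-const : ∀ (xs : List A) c → ∑ xs (λ _ → c) ≡ length xs * c
  ∑-const []       c = refl
  ∑-const (x ∷ xs) c = cong (c +_) (∑-const xs c)

  ∑-≤-length : ∀ xs {f : A → ℕ} {c} → (∀ {x} → x ∈ xs → f x ≤ c) → ∑ xs f ≤ length xs * c
  ∑-≤-length xs {c = c} h = ≤-trans (∑-mono xs h) (≤-reflexive (∑-const xs c))

  ∑-term : ∀ {xs} {f : A → ℕ} {x} → x ∈ xs → f x ≤ ∑ xs f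
  ∑-term (here refl) = m≤m+n _ _
  ∑-term (there x∈)  = ≤-trans (∑-term x∈) (m≤n+m _ _)

  ∑-+ : ∀ xs (f g : A → ℕ) → (∑ xs λ x → f x + g x) ≡ ∑ xs f + ∑ xs g
  ∑-+ []       f g = refl
  ∑-+ (x ∷ xs) f g = trans (cong (f x + g x +_) (∑-+ xs f g)) (+-interchange (f x) (g x) (∑ xs f) (∑ xs g))
    where
    +-interchange : ∀ a b c d → a + b + (c + d) ≡ a + c + (b + d)
    +-interchange = solve-∀

  ∑-*ˡ : ∀ xs c (f : A → ℕ) → (∑ xs λ x → c * f x) ≡ c * ∑ xs f
  ∑-*ˡ []       c f = sym (*-zeroʳ c)
  ∑-*ˡ (x ∷ xs) c f = trans (cong (c * f x +_) (∑-*ˡ xs c f)) (sym (*-distribˡ-+ c (f x) (∑ xs f)))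

  ∑-swap : ∀ xs ys (f : A → B → ℕ) → (∑ xs λ x → ∑ ys λ y → f x y) ≡ (∑ ys λ y → ∑ xs λ x → f x y)
  ∑-swap []       ys f = sym (trans (∑-const ys 0) (*-zeroʳ (length ys)))
  ∑-swap (x ∷ xs) ys f = trans (cong (∑ ys (f x) +_) (∑-swap xs ys f)) (sym (∑-+ ys (f x) _))

  ∑-*-∑ : ∀ xs ys (f : A → ℕ) (g : B → ℕ) → ∑ xs f * ∑ ys g ≡ (∑ xs λ x → ∑ ys λ y → f x * g y)
  ∑-*-∑ []       ys f g = refl
  ∑-*-∑ (x ∷ xs) ys f g = trans (*-distribʳ-+ (∑ ys g) (f x) (∑ xs f))
    (cong₂ _+_ (sym (∑-*ˡ ys (f x) g)) (∑-*-∑ xs ys f g))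

  ∑-++ : ∀ xs ys (f : A → ℕ) → ∑ (xs ++ ys) f ≡ ∑ xs f + ∑ ys f
  ∑-++ []       ys f = refl
  ∑-++ (x ∷ xs) ys f = trans (cong (f x +_) (∑-++ xs ys f)) (sym (+-assoc (f x) _ _))

  ∑-map : ∀ (h : A → B) xs (f : B → ℕ) → ∑ (map h xs) f ≡ ∑ xs (f ∘ h)
  ∑-map h []       f = refl
  ∑-map h (x ∷ xs) f = cong (f (h x) +_) (∑-map h xs f)

  ∑-cartesianProductWith : ∀ (h : A → B → C) xs ys (f : C → ℕ) →
    ∑ (cartesianProductWith h xs ys) f ≡ (∑ xs λ x → ∑ ys λ y → f (h x y))
  ∑-cartesianProductWith h []       ys f = refl
  ∑-cartesianProductWith h (x ∷ xs) ys f = trans (∑-++ (map (h x) ys) _ f)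
    (cong₂ _+_ (∑-map (h x) ys f) (∑-cartesianProductWith h xs ys f))

  ∑-filter-≤ : ∀ {P : A → Set} (P? : Decidable P) xs (f : A → ℕ) → ∑ (filter P? xs) f ≤ ∑ xs f
  ∑-filter-≤ P? []       f = z≤n
  ∑-filter-≤ P? (x ∷ xs) f with P? x
  ... | yes _ = +-monoʳ-≤ (f x) (∑-filter-≤ P? xs f)
  ... | no _  = ≤-trans (∑-filter-≤ P? xs f) (m≤n+m _ _)

  -- Once the head satisfies `P`, a later element satisfying it would equal the head, against
  -- `Unique`. This turns "is determined by" into a bound on a count.
  ∑-𝟙-unique : ∀ {P : A → Set} (P? : Decidable P) {xs} → Unique xs →
    (∀ {x y} → P x → P y → x ≡ y) → (∑ xs λ x → 𝟙 (P? x)) ≤ 1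
  ∑-𝟙-unique P? [] inj = z≤n
  ∑-𝟙-unique P? {x ∷ xs} (x∉ ∷ uniq) inj with P? x
  ... | no _  = ∑-𝟙-unique P? uniq inj
  ... | yes p = ≤-reflexive (cong suc (n≤0⇒n≡0 (≤-trans (∑-≤-length xs absent) (≤-reflexive (*-zeroʳ (length xs))))))
    where
    absent : ∀ {y} → y ∈ xs → 𝟙 (P? y) ≤ 0
    absent {y} y∈ = 𝟙-≤ (P? y) λ q → contradiction (inj p q) (All.lookup x∉ y∈)

  -- Without subtraction, the square of `x - y` is replaced by a simultaneous induction: raising
  -- both numbers by one adds `2 * (x + y + 1)` to either side.
  2xy≤x²+y² : ∀ x y → 2 * (x * y) ≤ x * x + y * y
  2xy≤x²+y² zero    y       = z≤n
  2xy≤x²+y² (suc x) zero    = ≤-trans (≤-reflexive (cong (2 *_) (*-zeroʳ (suc x)))) z≤n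
  2xy≤x²+y² (suc x) (suc y) = begin
    2 * (suc x * suc y)              ≡⟨ lhs x y ⟩
    2 * (x * y) + 2 * (x + y + 1)    ≤⟨ +-monoˡ-≤ _ (2xy≤x²+y² x y) ⟩
    x * x + y * y + 2 * (x + y + 1)  ≡⟨ rhs x y ⟩
    suc x * suc x + suc y * suc y    ∎
    where
    lhs : ∀ x y → 2 * (suc x * suc y) ≡ 2 * (x * y) + 2 * (x + y + 1)
    lhs = solve-∀
    rhs : ∀ x y → x * x + y * y + 2 * (x + y + 1) ≡ suc x * suc x + suc y * suc y
    rhs = solve-∀

  -- Induction on the list: in the square of `a + s` the cross term `2 * (a * s)` is a sum of terms
  -- `2 * (a * f y)`, each at most `a * a + f y * f y`.
  ∑-cauchySchwarz : ∀ xs (f : A → ℕ) → ∑ xs f * ∑ xs f ≤ length xs * (∑ xs λ x → f x * f x)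
  ∑-cauchySchwarz []       f = z≤n
  ∑-cauchySchwarz (x ∷ xs) f = begin
    (a + s) * (a + s)                  ≡⟨ square a s ⟩
    a * a + 2 * (a * s) + s * s        ≤⟨ +-mono-≤ (+-monoʳ-≤ (a * a) cross) (∑-cauchySchwarz xs f) ⟩
    a * a + (l * (a * a) + t) + l * t  ≡⟨ collect (a * a) l t ⟩
    (a * a + t) + l * (a * a + t)      ∎
    where
    a s l t : ℕ
    a = f x
    s = ∑ xs f
    l = length xs
    t = ∑ xs λ y → f y * f y
    square : ∀ a s → (a + s) * (a + s) ≡ a * a + 2 * (a * s) + s * s
    square = solve-∀
    collect : ∀ b l t → b + (l * b + t) + l * t ≡ (b + t) + l * (b + t)
    collect = solve-∀
    cross : 2 * (a * s) ≤ l * (a * a) + t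
    cross = begin
      2 * (a * s)                           ≡⟨ cong (2 *_) (∑-*ˡ xs a f) ⟨
      2 * (∑ xs λ y → a * f y)              ≡⟨ ∑-*ˡ xs 2 _ ⟨
      (∑ xs λ y → 2 * (a * f y))            ≤⟨ ∑-mono xs (λ {y} _ → 2xy≤x²+y² a (f y)) ⟩
      (∑ xs λ y → a * a + f y * f y)        ≡⟨ ∑-+ xs _ _ ⟩
      (∑ xs λ _ → a * a) + t                ≡⟨ cong (_+ t) (∑-const xs (a * a)) ⟩
      l * (a * a) + t                       ∎

open FiniteSums

-- The divisor bound.

module DivisorBound where
  open import Data.Nat using (_*_; _<_; _/_)
  open ≤-Reasoning

  ^-distribʳ-* : ∀ k m n → (m * n) ^ k ≡ m ^ k * n ^ k
  ^-distribʳ-* zero    m n = refl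
  ^-distribʳ-* (suc k) m n = trans (cong (m * n *_) (^-distribʳ-* k m n)) (interchange m n (m ^ k) (n ^ k))
    where
    interchange : ∀ a b c d → a * b * (c * d) ≡ a * c * (b * d)
    interchange = solve-∀

  ^-cancelʳ-≤ : ∀ k .{{_ : NonZero k}} {m n} → m ^ k ≤ n ^ k → m ≤ n
  ^-cancelʳ-≤ k mᵏ≤nᵏ = ≮⇒≥ λ n<m → <⇒≱ (^-monoˡ-< k n<m) mᵏ≤nᵏ

  ^-swap : ∀ m k l → (m ^ k) ^ l ≡ (m ^ l) ^ k
  ^-swap m k l = trans (^-*-assoc m k l) (trans (cong (m ^_) (*-comm k l)) (sym (^-*-assoc m l k)))

  m≤m^n : ∀ m n .{{_ : NonZero m}} .{{_ : NonZero n}} → m ≤ m ^ n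
  m≤m^n m (suc n) = m≤m*n m (m ^ n) {{m^n≢0 m n}}

  n<2^n : ∀ n → n < 2 ^ n
  n<2^n zero    = ≤-refl
  n<2^n (suc n) = begin-strict
    suc n              ≤⟨ n<2^n n ⟩
    2 ^ n              <⟨ m<m+n (2 ^ n) (≤-trans (m^n>0 2 n) (m≤m+n (2 ^ n) 0)) ⟩
    2 ^ suc n          ∎

  -- e + 1 ≤ k (⌊e / k⌋ + 1) ≤ k 2^⌊e / k⌋; now take k-th powers.
  [1+e]^k≤k^k*2^e : ∀ k .{{_ : NonZero k}} e → suc e ^ k ≤ k ^ k * 2 ^ e
  [1+e]^k≤k^k*2^e k e = begin
    suc e ^ k                       ≤⟨ ^-monoˡ-≤ k 1+e≤ ⟩
    (k * 2 ^ (e / k)) ^ k           ≡⟨ ^-distribʳ-* k k (2 ^ (e / k)) ⟩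
    k ^ k * (2 ^ (e / k)) ^ k       ≡⟨ cong (k ^ k *_) (^-*-assoc 2 (e / k) k) ⟩
    k ^ k * 2 ^ (e / k * k)         ≤⟨ *-monoʳ-≤ (k ^ k) (^-monoʳ-≤ 2 (m/n*n≤m e k)) ⟩
    k ^ k * 2 ^ e                   ∎
    where
    1+e≤ : suc e ≤ k * 2 ^ (e / k)
    1+e≤ = begin
      suc e                     ≡⟨ cong suc (m≡m%n+[m/n]*n e k) ⟩
      suc (e % k) + e / k * k   ≤⟨ +-monoˡ-≤ _ (m%n<n e k) ⟩
      suc (e / k) * k           ≤⟨ *-monoˡ-≤ k (n<2^n (e / k)) ⟩
      2 ^ (e / k) * k           ≡⟨ *-comm (2 ^ (e / k)) k ⟩
      k * 2 ^ (e / k)           ∎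

  range : ℕ → List ℕ
  range = applyDownFrom suc

  ∈-range⁻ : ∀ {n x} → x ∈ range n → 1 ≤ x × x ≤ n
  ∈-range⁻ x∈ with ∈-applyDownFrom⁻ suc x∈
  ... | _ , i<n , refl = s≤s z≤n , i<n

  ∈-range⁺ : ∀ {n x} → 1 ≤ x → x ≤ n → x ∈ range n
  ∈-range⁺ (s≤s z≤n) x≤n = ∈-applyDownFrom⁺ suc x≤n

  range-unique : ∀ n → Unique (range n)
  range-unique n = applyDownFrom⁺₁ suc n λ j<i _ i≡j → <⇒≢ j<i (sym (suc-injective i≡j))

  length-range : ∀ n → length (range n) ≡ n
  length-range = length-applyDownFrom suc

  -- Only divisors up to `N` are counted, so that the counts for different `m` are sums over one
  -- fixed list. The bounds below are uniform in `N`.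
  divisorCount : ℕ → ℕ → ℕ
  divisorCount N m = ∑ (range N) λ y → 𝟙 (y ∣? m)

  divisorCount-mono-∣ : ∀ N {m n} → m ∣ n → divisorCount N m ≤ divisorCount N n
  divisorCount-mono-∣ N {m} {n} m∣n = ∑-mono (range N) λ {y} _ → 𝟙-mono (y ∣? m) (y ∣? n) λ y∣m → ∣-trans y∣m m∣n

  divisorCount-1 : ∀ N → divisorCount N 1 ≤ 1
  divisorCount-1 N = ∑-𝟙-unique (_∣? 1) (range-unique N) λ x∣1 y∣1 → trans (∣1⇒≡1 x∣1) (sym (∣1⇒≡1 y∣1))

  module _ {p : ℕ} (pr : Prime p) where
    private instance
      _ = prime⇒nonZero pr

    -- A common divisor of `y` and the prime `p` is 1 or `p`, and `p` is excluded. So `y` is coprime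
    -- to `p`, and the factors `p` can be removed one at a time.
    ∤-∣-^* : ∀ {y m} → ¬ p ∣ y → ∀ e → y ∣ p ^ e * m → y ∣ m
    ∤-∣-^* {y} {m} p∤y zero    y∣ = subst (y ∣_) (*-identityˡ m) y∣
    ∤-∣-^* {y} {m} p∤y (suc e) y∣ = ∤-∣-^* p∤y e (coprime-divisor cop (subst (y ∣_) (*-assoc p (p ^ e) m) y∣))
      where
      cop : Coprime y p
      cop (d∣y , d∣p) with prime⇒irreducible pr d∣p
      ... | inj₁ d≡1  = d≡1
      ... | inj₂ refl = contradiction d∣y p∤y

    -- A divisor `y` of `p ^ suc e * m` either is prime to `p`, hence divides `m`, or is `p * z`
    -- with `z` dividing `p ^ e * m`; as `z ≤ y`, it survives the truncation at `N`. Since `z`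
    -- determines `y`, the second kind is covered by the case `e`.
    divisorCount-prime-^ : ∀ N m e → divisorCount N (p ^ e * m) ≤ suc e * divisorCount N m
    divisorCount-prime-^ N m zero    = ≤-reflexive (trans (cong (divisorCount N) (*-identityˡ m)) (sym (*-identityˡ _)))
    divisorCount-prime-^ N m (suc e) = begin
      divisorCount N (p ^ suc e * m)
        ≤⟨ ∑-mono (range N) split ⟩
      (∑ (range N) λ y → 𝟙 (y ∣? m) + (∑ (range N) λ z → 𝟙 (z ∣? M) * 𝟙 (y ≟ p * z)))
        ≡⟨ ∑-+ (range N) _ _ ⟩
      divisorCount N m + (∑ (range N) λ y → ∑ (range N) λ z → 𝟙 (z ∣? M) * 𝟙 (y ≟ p * z))
        ≡⟨ cong (divisorCount N m +_) (∑-swap (range N) (range N) _) ⟩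
      divisorCount N m + (∑ (range N) λ z → ∑ (range N) λ y → 𝟙 (z ∣? M) * 𝟙 (y ≟ p * z))
        ≤⟨ +-monoʳ-≤ (divisorCount N m) (∑-mono (range N) λ {z} _ → atMostOnce z) ⟩
      divisorCount N m + divisorCount N M
        ≤⟨ +-monoʳ-≤ (divisorCount N m) (divisorCount-prime-^ N m e) ⟩
      suc (suc e) * divisorCount N m
        ∎
      where
      M : ℕ
      M = p ^ e * m
      atMostOnce : ∀ z → (∑ (range N) λ y → 𝟙 (z ∣? M) * 𝟙 (y ≟ p * z)) ≤ 𝟙 (z ∣? M)
      atMostOnce z = begin
        (∑ (range N) λ y → 𝟙 (z ∣? M) * 𝟙 (y ≟ p * z))  ≡⟨ ∑-*ˡ (range N) (𝟙 (z ∣? M)) _ ⟩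
        𝟙 (z ∣? M) * (∑ (range N) λ y → 𝟙 (y ≟ p * z))
          ≤⟨ *-monoʳ-≤ (𝟙 (z ∣? M)) (∑-𝟙-unique (_≟ p * z) (range-unique N) λ x≡ y≡ → trans x≡ (sym y≡)) ⟩
        𝟙 (z ∣? M) * 1                                   ≡⟨ *-identityʳ _ ⟩
        𝟙 (z ∣? M)                                       ∎
      split : ∀ {y} → y ∈ range N →
        𝟙 (y ∣? p ^ suc e * m) ≤ 𝟙 (y ∣? m) + (∑ (range N) λ z → 𝟙 (z ∣? M) * 𝟙 (y ≟ p * z))
      split {y} y∈ = 𝟙-≤ (y ∣? p ^ suc e * m) λ y∣ → cases y∣ (p ∣? y)
        where
        cases : y ∣ p ^ suc e * m → Dec (p ∣ y) →
          1 ≤ 𝟙 (y ∣? m) + (∑ (range N) λ z → 𝟙 (z ∣? M) * 𝟙 (y ≟ p * z))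
        cases y∣ (no p∤y) = ≤-trans (≤-reflexive (sym (𝟙-true (y ∣? m) (∤-∣-^* p∤y (suc e) y∣)))) (m≤m+n _ _)
        cases y∣ (yes (divides z y≡z*p)) = begin
          1                             ≡⟨ cong₂ _*_ (𝟙-true (z ∣? M) z∣M) (𝟙-true (y ≟ p * z) y≡p*z) ⟨
          𝟙 (z ∣? M) * 𝟙 (y ≟ p * z)    ≤⟨ ∑-term {f = λ z → 𝟙 (z ∣? M) * 𝟙 (y ≟ p * z)} (∈-range⁺ 1≤z z≤N) ⟩
          (∑ (range N) λ z → 𝟙 (z ∣? M) * 𝟙 (y ≟ p * z))  ≤⟨ m≤n+m _ (𝟙 (y ∣? m)) ⟩
          𝟙 (y ∣? m) + (∑ (range N) λ z → 𝟙 (z ∣? M) * 𝟙 (y ≟ p * z)) ∎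
          where
          y≡p*z : y ≡ p * z
          y≡p*z = trans y≡z*p (*-comm z p)
          z∣M : z ∣ M
          z∣M = *-cancelˡ-∣ p (subst₂ _∣_ y≡p*z (*-assoc p (p ^ e) m) y∣)
          1≤z : 1 ≤ z
          1≤z = n≢0⇒n>0 λ { refl → <⇒≢ (proj₁ (∈-range⁻ y∈)) (sym y≡z*p) }
          z≤N : z ≤ N
          z≤N = ≤-trans (m≤m*n z p) (≤-trans (≤-reflexive (sym y≡z*p)) (proj₂ (∈-range⁻ y∈)))

  valuation : ∀ p → 1 < p → ∀ m → 1 ≤ m → ∃₂ λ e m′ → m ≡ p ^ e * m′ × ¬ p ∣ m′
  valuation p 1<p = <-rec _ step
    where
    step : ∀ m → (∀ {k} → k < m → 1 ≤ k → ∃₂ λ e m′ → k ≡ p ^ e * m′ × ¬ p ∣ m′) →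
      1 ≤ m → ∃₂ λ e m′ → m ≡ p ^ e * m′ × ¬ p ∣ m′
    step m rec 1≤m with p ∣? m
    ... | no p∤m = 0 , m , sym (*-identityˡ m) , p∤m
    ... | yes (divides zero refl) = contradiction 1≤m λ ()
    ... | yes (divides k@(suc _) refl) with rec {k} (m<m*n k p 1<p) (s≤s z≤n)
    ...   | e , m′ , k≡ , p∤m′ = suc e , m′ ,
              trans (*-comm k p) (trans (cong (p *_) k≡) (sym (*-assoc p (p ^ e) m′))) , p∤m′

  primeFactor : ∀ m → 1 < m → ∃ λ p → Prime p × p ∣ m
  primeFactor m 1<m = go (PrimeFactorisation.factors f) (PrimeFactorisation.isFactorisation f) (PrimeFactorisation.factorsPrime f)
    where
    f = factorise m {{>-nonZero (<⇒≤ 1<m)}}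
    go : ∀ ps → m ≡ product ps → All Prime ps → ∃ λ p → Prime p × p ∣ m
    go []       m≡1 []       = contradiction (sym m≡1) (<⇒≢ 1<m)
    go (p ∷ ps) m≡  (pr ∷ _) = p , pr , divides (product ps) (trans m≡ (*-comm p _))

  -- The strict bound lets an induction on `b` strip off the prime `b - 1`, and makes every `m ≥ 1`
  -- smooth for `b = m + 1`.
  Smooth : ℕ → ℕ → Set
  Smooth b m = ∀ {r} → Prime r → r ∣ m → r < b

  module _ (k : ℕ) {{_ : NonZero k}} where
    private
      c : ℕ
      c = k ^ k
      instance
        c≢0 : NonZero c
        c≢0 = m^n≢0 k k

    -- A prime p < 2^k costs the constant c; a larger prime costs nothing.
    [1+e]^k-bound : ∀ p e → 1 < p → suc e ^ k * c ^ (p ⊓ 2 ^ k) ≤ c ^ (suc p ⊓ 2 ^ k) * p ^ e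
    [1+e]^k-bound p e 1<p with p <? 2 ^ k
    ... | yes p<2^k = begin
      suc e ^ k * c ^ (p ⊓ 2 ^ k)       ≡⟨ cong (λ t → suc e ^ k * c ^ t) (m≤n⇒m⊓n≡m (<⇒≤ p<2^k)) ⟩
      suc e ^ k * c ^ p                 ≤⟨ *-monoˡ-≤ (c ^ p) ([1+e]^k≤k^k*2^e k e) ⟩
      c * 2 ^ e * c ^ p                 ≤⟨ *-monoˡ-≤ (c ^ p) (*-monoʳ-≤ c (^-monoˡ-≤ e 1<p)) ⟩
      c * p ^ e * c ^ p                 ≡⟨ swap c (p ^ e) (c ^ p) ⟩
      c ^ suc p * p ^ e                 ≡⟨ cong (λ t → c ^ t * p ^ e) (m≤n⇒m⊓n≡m p<2^k) ⟨
      c ^ (suc p ⊓ 2 ^ k) * p ^ e       ∎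
      where
      swap : ∀ a b c → a * b * c ≡ a * c * b
      swap = solve-∀
    ... | no p≮2^k = begin
      suc e ^ k * c ^ (p ⊓ 2 ^ k)       ≡⟨ cong (λ t → suc e ^ k * c ^ t) (m≥n⇒m⊓n≡n 2^k≤p) ⟩
      suc e ^ k * c ^ (2 ^ k)           ≤⟨ *-monoˡ-≤ (c ^ (2 ^ k)) (^-monoˡ-≤ k (n<2^n e)) ⟩
      (2 ^ e) ^ k * c ^ (2 ^ k)         ≡⟨ cong (_* c ^ (2 ^ k)) (^-swap 2 e k) ⟩
      (2 ^ k) ^ e * c ^ (2 ^ k)         ≤⟨ *-monoˡ-≤ (c ^ (2 ^ k)) (^-monoˡ-≤ e 2^k≤p) ⟩
      p ^ e * c ^ (2 ^ k)               ≡⟨ *-comm (p ^ e) _ ⟩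
      c ^ (2 ^ k) * p ^ e               ≡⟨ cong (λ t → c ^ t * p ^ e) (m≥n⇒m⊓n≡n (m≤n⇒m≤1+n 2^k≤p)) ⟨
      c ^ (suc p ⊓ 2 ^ k) * p ^ e       ∎
      where
      2^k≤p : 2 ^ k ≤ p
      2^k≤p = ≮⇒≥ p≮2^k

    -- Induction on `b`: `valuation` removes the full power of the prime `p = b - 1`, and
    -- `[1+e]^k-bound` pays for it. The exponent `b ⊓ 2 ^ k` counts all integers below both `b` and
    -- `2 ^ k`, an upper bound for the number of primes that cost a factor `c`.
    divisorCount-smooth : ∀ N b m → 1 ≤ m → Smooth b m → divisorCount N m ^ k ≤ c ^ (b ⊓ 2 ^ k) * m
    divisorCount-smooth N zero m 1≤m smooth with m ≟ 1
    -- No prime lies below 0, so only `m ≡ 1` remains.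
    ... | no m≢1 with primeFactor m (≤∧≢⇒< 1≤m (m≢1 ∘ sym))
    ...   | _ , pr , p∣m = contradiction (smooth pr p∣m) λ ()
    divisorCount-smooth N zero m 1≤m smooth | yes refl = ≤-trans (^-monoˡ-≤ k (divisorCount-1 N)) (≤-reflexive (^-zeroˡ k))
    divisorCount-smooth N (suc p) m 1≤m smooth with prime? p
    -- If `p` is not prime, no prime factor of `m` equals `p`, so `m` already falls under the
    -- previous case; the exponent of `c` can only grow.
    ... | no ¬pr = ≤-trans (divisorCount-smooth N p m 1≤m smooth′)
                     (*-monoˡ-≤ m (^-monoʳ-≤ c (⊓-monoˡ-≤ (2 ^ k) (n≤1+n p))))
      where
      smooth′ : Smooth p m
      smooth′ pr r∣m = ≤∧≢⇒< (m<1+n⇒m≤n (smooth pr r∣m)) λ { refl → ¬pr pr }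
    ... | yes pr with valuation p 1<p m 1≤m
      where
      1<p : 1 < p
      1<p = nonTrivial⇒n>1 p {{prime⇒nonTrivial pr}}
    ...   | e , m′ , refl , p∤m′ = begin
      divisorCount N (p ^ e * m′) ^ k                   ≤⟨ ^-monoˡ-≤ k (divisorCount-prime-^ pr N m′ e) ⟩
      (suc e * divisorCount N m′) ^ k                   ≡⟨ ^-distribʳ-* k (suc e) _ ⟩
      suc e ^ k * divisorCount N m′ ^ k                 ≤⟨ *-monoʳ-≤ (suc e ^ k) (divisorCount-smooth N p m′ 1≤m′ smooth′) ⟩
      suc e ^ k * (c ^ (p ⊓ 2 ^ k) * m′)                ≡⟨ *-assoc (suc e ^ k) _ m′ ⟨
      suc e ^ k * c ^ (p ⊓ 2 ^ k) * m′                  ≤⟨ *-monoˡ-≤ m′ ([1+e]^k-bound p e (nonTrivial⇒n>1 p {{prime⇒nonTrivial pr}})) ⟩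
      c ^ (suc p ⊓ 2 ^ k) * p ^ e * m′                  ≡⟨ *-assoc (c ^ (suc p ⊓ 2 ^ k)) (p ^ e) m′ ⟩
      c ^ (suc p ⊓ 2 ^ k) * (p ^ e * m′)                ∎
      where
      1≤m′ : 1 ≤ m′
      1≤m′ = n≢0⇒n>0 λ { refl → p∤m′ (p ∣0) }
      smooth′ : Smooth p m′
      smooth′ r r∣m′ = ≤∧≢⇒< (m<1+n⇒m≤n (smooth r (∣n⇒∣m*n (p ^ e) r∣m′))) λ { refl → p∤m′ r∣m′ }

  -- The cap `2 ^ k` on the exponent in `divisorCount-smooth` makes the constant independent of `m`,
  -- so the trivial choice `b = m + 1` suffices.
  divisorBound : ∀ k .{{_ : NonZero k}} → ∃ λ C → 1 ≤ C × (∀ N m → 1 ≤ m → divisorCount N m ^ k ≤ C * m)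
  divisorBound k@(suc _) = c ^ (2 ^ k) , m^n>0 c (2 ^ k) , λ N m 1≤m → ≤-trans
    (divisorCount-smooth k N (suc m) m 1≤m λ _ r∣m → s≤s (∣⇒≤ {{>-nonZero 1≤m}} r∣m))
    (*-monoˡ-≤ m (^-monoʳ-≤ c (m⊓n≤n (suc m) (2 ^ k))))
    where
    c : ℕ
    c = k ^ k
    instance
      c≢0 : NonZero c
      c≢0 = m^n≢0 k k

open DivisorBound

-- Products of tuples, their representations and the multiplicative energy.

module Energy where
  open import Data.Nat using (_*_; _<_)
  open ≤-Reasoning

  -- Products are listed with multiplicity, one for each `l`-tuple from `[1, n]`, so a sum over this
  -- list is a sum over tuples.
  prods : ℕ → ℕ → List ℕ
  prods n zero    = 1 ∷ []
  prods n (suc l) = cartesianProductWith _*_ (range n) (prods n l)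

  ∑-prods-suc : ∀ n l f → ∑ (prods n (suc l)) f ≡ (∑ (range n) λ y → ∑ (prods n l) λ Y → f (y * Y))
  ∑-prods-suc n l f = ∑-cartesianProductWith _*_ (range n) (prods n l) f

  ∑-prods-≤ : ∀ n l {f c} → (∀ {Y} → Y ∈ prods n l → f Y ≤ c) → ∑ (prods n l) f ≤ n ^ l * c
  ∑-prods-≤ n l {c = c} h = ≤-trans (∑-mono (prods n l) h) (≤-reflexive (const l))
    where
    const : ∀ l → ∑ (prods n l) (λ _ → c) ≡ n ^ l * c
    const zero    = refl
    const (suc l) = begin-equality
      ∑ (prods n (suc l)) (λ _ → c)                  ≡⟨ ∑-prods-suc n l _ ⟩
      (∑ (range n) λ _ → ∑ (prods n l) λ _ → c)      ≡⟨ ∑-const (range n) _ ⟩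
      length (range n) * ∑ (prods n l) (λ _ → c)     ≡⟨ cong₂ _*_ (length-range n) (const l) ⟩
      n * (n ^ l * c)                                ≡⟨ *-assoc n (n ^ l) c ⟨
      n ^ suc l * c                                  ∎

  ∈-prods⁻ : ∀ n l {Y} → Y ∈ prods n l → 1 ≤ Y × Y ≤ n ^ l
  ∈-prods⁻ n zero    (here refl) = ≤-refl , ≤-refl
  ∈-prods⁻ n (suc l) Y∈ with ∈-cartesianProductWith⁻ _*_ (range n) (prods n l) Y∈
  ... | y , Y , y∈ , Y∈ , refl = *-mono-≤ (proj₁ (∈-range⁻ y∈)) (proj₁ (∈-prods⁻ n l Y∈))
                               , *-mono-≤ (proj₂ (∈-range⁻ y∈)) (proj₂ (∈-prods⁻ n l Y∈))

  -- The first factor `y` must divide `M`, and the others represent `M / y`, which has at most as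
  -- many divisors up to `n` as `M`. Each of the `l` factors thus offers at most `divisorCount n M`
  -- choices.
  representations-≤ : ∀ n l M → 1 ≤ M → (∑ (prods n l) λ Y → 𝟙 (Y ≟ M)) ≤ divisorCount n M ^ l
  representations-≤ n zero    M 1≤M = ≤-trans (≤-reflexive (+-identityʳ _)) (𝟙≤1 (1 ≟ M))
  representations-≤ n (suc l) M 1≤M = begin
    (∑ (prods n (suc l)) λ Y → 𝟙 (Y ≟ M))                     ≡⟨ ∑-prods-suc n l _ ⟩
    (∑ (range n) λ y → ∑ (prods n l) λ Y → 𝟙 (y * Y ≟ M))     ≤⟨ ∑-mono (range n) (λ {y} _ → fixed y (y ∣? M)) ⟩
    (∑ (range n) λ y → d ^ l * 𝟙 (y ∣? M))                    ≡⟨ ∑-*ˡ (range n) (d ^ l) _ ⟩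
    d ^ l * d                                                 ≡⟨ *-comm (d ^ l) d ⟩
    d ^ suc l                                                 ∎
    where
    d : ℕ
    d = divisorCount n M
    fixed : ∀ y (y∣?M : Dec (y ∣ M)) → (∑ (prods n l) λ Y → 𝟙 (y * Y ≟ M)) ≤ d ^ l * 𝟙 y∣?M
    fixed y (no y∤M) = ≤-trans
      (∑-≤-length (prods n l) {c = 0} λ {Y} _ → 𝟙-≤ (y * Y ≟ M) λ yY≡M →
        contradiction (divides Y (trans (sym yY≡M) (*-comm y Y))) y∤M)
      (≤-trans (≤-reflexive (*-zeroʳ (length (prods n l)))) z≤n)
    fixed y (yes (divides z refl)) = begin
      (∑ (prods n l) λ Y → 𝟙 (y * Y ≟ z * y))  ≤⟨ ∑-mono (prods n l) (λ {Y} _ → 𝟙-mono (y * Y ≟ z * y) (Y ≟ z) (cancel Y)) ⟩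
      (∑ (prods n l) λ Y → 𝟙 (Y ≟ z))          ≤⟨ representations-≤ n l z 1≤z ⟩
      divisorCount n z ^ l                     ≤⟨ ^-monoˡ-≤ l (divisorCount-mono-∣ n (m∣m*n y)) ⟩
      d ^ l                                    ≡⟨ *-identityʳ _ ⟨
      d ^ l * 1                                ∎
      where
      1≤z : 1 ≤ z
      1≤z = n≢0⇒n>0 λ { refl → contradiction 1≤M λ () }
      1≤y : 1 ≤ y
      1≤y = n≢0⇒n>0 λ { refl → contradiction (subst (1 ≤_) (*-zeroʳ z) 1≤M) λ () }
      cancel : ∀ Y → y * Y ≡ z * y → Y ≡ z
      cancel Y eq = *-cancelˡ-≡ Y z y {{>-nonZero 1≤y}} (trans eq (*-comm z y))

  -- With exponent k², the divisor bound makes the k-th power of d(M)^k at most C M ≤ C n^k.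
  representationBound : ∀ k .{{_ : NonZero k}} → ∃ λ C → 1 ≤ C ×
    (∀ n M → M ∈ prods n k → (∑ (prods n k) λ Y → 𝟙 (Y ≟ M)) ≤ C * n)
  representationBound k@(suc _) with divisorBound (k * k)
  ... | C , 1≤C , bound = C , 1≤C , λ n M M∈ → ≤-trans
          (representations-≤ n k M (proj₁ (∈-prods⁻ n k M∈)))
          (^-cancelʳ-≤ k (begin
            (divisorCount n M ^ k) ^ k   ≡⟨ ^-*-assoc (divisorCount n M) k k ⟩
            divisorCount n M ^ (k * k)   ≤⟨ bound n M (proj₁ (∈-prods⁻ n k M∈)) ⟩
            C * M                        ≤⟨ *-mono-≤ (m≤m^n C k {{>-nonZero 1≤C}}) (proj₂ (∈-prods⁻ n k M∈)) ⟩
            C ^ k * n ^ k                ≡⟨ ^-distribʳ-* k C n ⟨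
            (C * n) ^ k                  ∎))

  module _ {n k D : ℕ} (bound : ∀ M → M ∈ prods n k → (∑ (prods n k) λ Y → 𝟙 (Y ≟ M)) ≤ D) where

    -- The hypothesis `bound` speaks of attained products only. If `p * M ≡ R` for some `M` in the
    -- list, cancelling `p` forces every solution to equal `M`, so the representations of `M` are
    -- counted; otherwise the count is zero.
    multiples-≤ : ∀ p R → 1 ≤ p → (∑ (prods n k) λ Y → 𝟙 (p * Y ≟ R)) ≤ D
    multiples-≤ p R 1≤p with any? (λ Y → p * Y ≟ R) (prods n k)
    ... | no none = ≤-trans
      (∑-≤-length (prods n k) {c = 0} λ {Y} Y∈ → 𝟙-≤ (p * Y ≟ R) λ eq → contradiction (Any.map (λ { refl → eq }) Y∈) none)
      (≤-trans (≤-reflexive (*-zeroʳ (length (prods n k)))) z≤n)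
    ... | yes some with find some
    ...   | M , M∈ , refl = ≤-trans
      (∑-mono (prods n k) λ {Y} _ → 𝟙-mono (p * Y ≟ p * M) (Y ≟ M) (*-cancelˡ-≡ Y M p {{>-nonZero 1≤p}}))
      (bound M M∈)

    solutions-≤ : ∀ p q → 1 ≤ p → (∑ (prods n k) λ Y → ∑ (prods n k) λ X → 𝟙 (p * Y ≟ q * X)) ≤ n ^ k * D
    solutions-≤ p q 1≤p = begin
      (∑ (prods n k) λ Y → ∑ (prods n k) λ X → 𝟙 (p * Y ≟ q * X))  ≡⟨ ∑-swap (prods n k) (prods n k) _ ⟩
      (∑ (prods n k) λ X → ∑ (prods n k) λ Y → 𝟙 (p * Y ≟ q * X))  ≤⟨ ∑-prods-≤ n k (λ {X} _ → multiples-≤ p (q * X) 1≤p) ⟩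
      n ^ k * D  ∎

  length-allFin : ∀ n → length (allFin n) ≡ n
  length-allFin n = length-tabulate id

  ∑-allFin-≤ : ∀ n {f c} → (∀ i → f i ≤ c) → ∑ (allFin n) f ≤ n * c
  ∑-allFin-≤ n {c = c} h = ≤-trans (∑-≤-length (allFin n) λ {i} _ → h i) (≤-reflexive (cong (_* c) (length-allFin n)))

  -- Powers of a symmetric matrix and iterated Cauchy-Schwarz.

  module SymmetricMatrix (n : ℕ) (W : Fin n → Fin n → ℕ) (W-sym : ∀ i j → W i j ≡ W j i) where

    -- The vector `W^l` applied to the all-ones vector, so that `totalWalks l` is the sum of all
    -- entries of `W^l`.
    walks : ℕ → Fin n → ℕ
    walks zero    i = 1
    walks (suc l) i = ∑ (allFin n) λ j → W i j * walks l j

    totalWalks : ℕ → ℕ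
    totalWalks l = ∑ (allFin n) (walks l)

    ⟨_,_⟩ : ℕ → ℕ → ℕ
    ⟨ l , m ⟩ = ∑ (allFin n) λ i → walks l i * walks m i

    -- Exchanging the two summations and replacing `W i j` by `W j i` moves one factor `W` from the
    -- left vector to the right one.
    selfAdjoint : ∀ l m → ⟨ suc l , m ⟩ ≡ ⟨ l , suc m ⟩
    selfAdjoint l m = begin-equality
      ⟨ suc l , m ⟩
        ≡⟨ ∑-cong (allFin n) (λ i → trans (*-comm _ (walks m i)) (sym (∑-*ˡ (allFin n) (walks m i) _))) ⟩
      (∑ (allFin n) λ i → ∑ (allFin n) λ j → walks m i * (W i j * walks l j))
        ≡⟨ ∑-swap (allFin n) (allFin n) _ ⟩
      (∑ (allFin n) λ j → ∑ (allFin n) λ i → walks m i * (W i j * walks l j))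
        ≡⟨ ∑-cong (allFin n) (λ j → ∑-cong (allFin n) λ i → trans
             (cong (λ w → walks m i * (w * walks l j)) (W-sym i j))
             (rotate (walks m i) (W j i) (walks l j))) ⟩
      (∑ (allFin n) λ j → ∑ (allFin n) λ i → walks l j * (W j i * walks m i))
        ≡⟨ ∑-cong (allFin n) (λ j → ∑-*ˡ (allFin n) (walks l j) _) ⟩
      ⟨ l , suc m ⟩
        ∎
      where
      rotate : ∀ a b c → a * (b * c) ≡ c * (b * a)
      rotate = solve-∀

    ⟨⟩≡totalWalks : ∀ l m → ⟨ l , m ⟩ ≡ totalWalks (l + m)
    ⟨⟩≡totalWalks zero    m = ∑-cong (allFin n) λ i → *-identityˡ (walks m i)
    ⟨⟩≡totalWalks (suc l) m = trans (selfAdjoint l m) (trans (⟨⟩≡totalWalks l (suc m)) (cong totalWalks (+-suc l m)))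

    -- Cauchy-Schwarz for the vector `walks l`, whose squared norm `⟨ l , l ⟩` is
    -- `totalWalks (l + l)`.
    totalWalks-square : ∀ l → totalWalks l * totalWalks l ≤ n * totalWalks (l + l)
    totalWalks-square l = ≤-trans (∑-cauchySchwarz (allFin n) (walks l))
      (≤-reflexive (cong₂ _*_ (length-allFin n) (⟨⟩≡totalWalks l l)))

    -- Squaring the case `m` and applying `totalWalks-square` doubles the exponent `K = 2 ^ m`. The
    -- factor `n` on the left avoids the subtraction in `n^(K - 1)`.
    totalWalks-power : 1 ≤ n → ∀ m → totalWalks 1 ^ (2 ^ m) * n ≤ n ^ (2 ^ m) * totalWalks (2 ^ m)
    totalWalks-power 1≤n zero = ≤-reflexive (swap (totalWalks 1) n)
      where
      swap : ∀ a b → a * 1 * b ≡ b * 1 * a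
      swap = solve-∀
    totalWalks-power 1≤n (suc m) = *-cancelʳ-≤ _ _ n {{>-nonZero 1≤n}} (begin
      E ^ (2 * K) * n * n            ≡⟨ cong (λ t → t * n * n) (double E) ⟩
      E ^ K * E ^ K * n * n          ≡⟨ regroup (E ^ K) n ⟩
      (E ^ K * n) * (E ^ K * n)      ≤⟨ *-mono-≤ (totalWalks-power 1≤n m) (totalWalks-power 1≤n m) ⟩
      (n ^ K * s) * (n ^ K * s)      ≡⟨ *-interchange (n ^ K) s ⟩
      n ^ K * n ^ K * (s * s)        ≤⟨ *-monoʳ-≤ (n ^ K * n ^ K) (totalWalks-square K) ⟩
      n ^ K * n ^ K * (n * totalWalks (K + K))  ≡⟨ cong₂ (λ a b → a * (n * totalWalks b)) (sym (double n)) (cong (K +_) (sym (+-identityʳ K))) ⟩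
      n ^ (2 * K) * (n * totalWalks (2 * K))  ≡⟨ last (n ^ (2 * K)) n (totalWalks (2 * K)) ⟩
      n ^ (2 * K) * totalWalks (2 * K) * n    ∎)
      where
      E K s : ℕ
      E = totalWalks 1
      K = 2 ^ m
      s = totalWalks K
      double : ∀ x → x ^ (2 * K) ≡ x ^ K * x ^ K
      double x = trans (cong (λ t → x ^ (K + t)) (+-identityʳ K)) (^-distribˡ-+-* x K K)
      regroup : ∀ a n → a * a * n * n ≡ (a * n) * (a * n)
      regroup = solve-∀
      *-interchange : ∀ a b → (a * b) * (a * b) ≡ a * a * (b * b)
      *-interchange = solve-∀
      last : ∀ a b c → a * (b * c) ≡ a * c * b
      last = solve-∀

  -- The matrix counting solutions of `a i * y ≡ a j * x`.

  module GCDMatrix {n : ℕ} (a : Fin n → ℕ) (1≤a : ∀ i → 1 ≤ a i) (a-injective : ∀ {i j} → a i ≡ a j → i ≡ j) where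

    W : Fin n → Fin n → ℕ
    W i j = ∑ (range n) λ y → ∑ (range n) λ x → 𝟙 (a i * y ≟ a j * x)

    W-sym : ∀ i j → W i j ≡ W j i
    W-sym i j = trans (∑-swap (range n) (range n) _)
      (∑-cong (range n) λ x → ∑-cong (range n) λ y → ≤-antisym
        (𝟙-mono (a i * y ≟ a j * x) (a j * x ≟ a i * y) sym)
        (𝟙-mono (a j * x ≟ a i * y) (a i * y ≟ a j * x) sym))

    open SymmetricMatrix n W W-sym public

    -- For `p = a i` and `q = a j` this is the upper bound for the entry of `W^l` at `i`, `j`: the
    -- equations along a walk are multiplied together and only their product is kept.
    G : ℕ → ℕ → ℕ → ℕ
    G l p q = ∑ (prods n l) λ Y → ∑ (prods n l) λ X → 𝟙 (p * Y ≟ q * X)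

    -- The intermediate vertex k of a walk is determined by a i * y ≡ a k * x.
    W-G-≤ : ∀ l i q → (∑ (allFin n) λ k → W i k * G l (a k) q) ≤ G (suc l) (a i) q
    W-G-≤ l i q = begin
      (∑ (allFin n) λ k → W i k * G l (a k) q)
        ≡⟨ ∑-cong (allFin n) expand ⟩
      (∑ (allFin n) λ k → ∑ (range n) λ y → ∑ (prods n l) λ Y → ∑ (range n) λ x → ∑ (prods n l) λ X →
         𝟙 (a i * y ≟ a k * x) * 𝟙 (a k * Y ≟ q * X))
        ≤⟨ into (range n) (λ {y} _ → into (prods n l) λ {Y} _ →
             into (range n) λ {x} x∈ → into (prods n l) λ {X} _ → pointwise y Y x X (proj₁ (∈-range⁻ x∈))) ⟩
      (∑ (range n) λ y → ∑ (prods n l) λ Y → ∑ (range n) λ x → ∑ (prods n l) λ X → 𝟙 (a i * (y * Y) ≟ q * (x * X)))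
        ≡⟨ ∑-cong (range n) (λ y → ∑-cong (prods n l) λ Y → ∑-prods-suc n l _) ⟨
      (∑ (range n) λ y → ∑ (prods n l) λ Y → ∑ (prods n (suc l)) λ X → 𝟙 (a i * (y * Y) ≟ q * X))
        ≡⟨ ∑-prods-suc n l _ ⟨
      G (suc l) (a i) q
        ∎
      where
      expand : ∀ k → W i k * G l (a k) q ≡ (∑ (range n) λ y → ∑ (prods n l) λ Y → ∑ (range n) λ x → ∑ (prods n l) λ X →
         𝟙 (a i * y ≟ a k * x) * 𝟙 (a k * Y ≟ q * X))
      expand k = trans (∑-*-∑ (range n) (prods n l) _ _)
        (∑-cong (range n) λ y → ∑-cong (prods n l) λ Y → ∑-*-∑ (range n) (prods n l) _ _)
      into : ∀ (xs : List ℕ) {f : Fin n → ℕ → ℕ} {g : ℕ → ℕ} →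
        (∀ {x} → x ∈ xs → (∑ (allFin n) λ k → f k x) ≤ g x) →
        (∑ (allFin n) λ k → ∑ xs (f k)) ≤ ∑ xs g
      into xs h = ≤-trans (≤-reflexive (∑-swap (allFin n) xs _)) (∑-mono xs h)
      compose : ∀ k y Y x X → a i * y ≡ a k * x → a k * Y ≡ q * X → a i * (y * Y) ≡ q * (x * X)
      compose k y Y x X e₁ e₂ = begin-equality
        a i * (y * Y)  ≡⟨ *-assoc (a i) y Y ⟨
        a i * y * Y    ≡⟨ cong (_* Y) e₁ ⟩
        a k * x * Y    ≡⟨ shuffle (a k) x Y ⟩
        x * (a k * Y)  ≡⟨ cong (x *_) e₂ ⟩
        x * (q * X)    ≡⟨ shuffle′ x q X ⟩
        q * (x * X)    ∎
        where
        shuffle : ∀ a b c → a * b * c ≡ b * (a * c)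
        shuffle = solve-∀
        shuffle′ : ∀ a b c → a * (b * c) ≡ b * (a * c)
        shuffle′ = solve-∀
      pointwise : ∀ y Y x X → 1 ≤ x →
        (∑ (allFin n) λ k → 𝟙 (a i * y ≟ a k * x) * 𝟙 (a k * Y ≟ q * X)) ≤ 𝟙 (a i * (y * Y) ≟ q * (x * X))
      pointwise y Y x X 1≤x = begin
        (∑ (allFin n) λ k → 𝟙 (a i * y ≟ a k * x) * 𝟙 (a k * Y ≟ q * X))
          ≤⟨ ∑-mono (allFin n) (λ {k} _ → 𝟙*-≤ (a i * y ≟ a k * x) λ e₁ → ≤-trans
               (𝟙-mono (a k * Y ≟ q * X) (a i * (y * Y) ≟ q * (x * X)) (compose k y Y x X e₁))
               (≤-reflexive (sym (trans (cong (t *_) (𝟙-true (a i * y ≟ a k * x) e₁)) (*-identityʳ t))))) ⟩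
        (∑ (allFin n) λ k → t * 𝟙 (a i * y ≟ a k * x))  ≡⟨ ∑-*ˡ (allFin n) t _ ⟩
        t * (∑ (allFin n) λ k → 𝟙 (a i * y ≟ a k * x))
          -- Two admissible `k` give equal values of `a` after cancelling the positive `x`, hence
          -- coincide by injectivity.
          ≤⟨ *-monoʳ-≤ t (∑-𝟙-unique (λ k → a i * y ≟ a k * x) (allFin⁺ n) λ {k} {k′} e e′ →
               a-injective (*-cancelʳ-≡ (a k) (a k′) x {{>-nonZero 1≤x}} (trans (sym e) e′))) ⟩
        t * 1                                           ≡⟨ *-identityʳ t ⟩
        t                                               ∎
        where
        t : ℕ
        t = 𝟙 (a i * (y * Y) ≟ q * (x * X))

    -- Induction on `l` with `W-G-≤` applied for each endpoint `j`. For `l = 0` the term `j = i`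
    -- alone contributes 1, from `Y = X = 1`.
    walks-≤-G : ∀ l i → walks l i ≤ ∑ (allFin n) λ j → G l (a i) (a j)
    walks-≤-G zero    i = ≤-trans
      (≤-reflexive (sym (cong (λ t → t + 0 + 0) (𝟙-true (a i * 1 ≟ a i * 1) refl))))
      (∑-term {f = λ j → G zero (a i) (a j)} (∈-allFin i))
    walks-≤-G (suc l) i = begin
      (∑ (allFin n) λ k → W i k * walks l k)
        ≤⟨ ∑-mono (allFin n) (λ {k} _ → *-monoʳ-≤ (W i k) (walks-≤-G l k)) ⟩
      (∑ (allFin n) λ k → W i k * ∑ (allFin n) λ j → G l (a k) (a j))
        ≡⟨ ∑-cong (allFin n) (λ k → ∑-*ˡ (allFin n) (W i k) _) ⟨
      (∑ (allFin n) λ k → ∑ (allFin n) λ j → W i k * G l (a k) (a j))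
        ≡⟨ ∑-swap (allFin n) (allFin n) _ ⟩
      (∑ (allFin n) λ j → ∑ (allFin n) λ k → W i k * G l (a k) (a j))
        ≤⟨ ∑-mono (allFin n) (λ {j} _ → W-G-≤ l i (a j)) ⟩
      (∑ (allFin n) λ j → G (suc l) (a i) (a j))
        ∎

    energy : ℕ
    energy = totalWalks 1

    energy≡ : energy ≡ ∑ (allFin n) λ i → ∑ (allFin n) λ j → W i j
    energy≡ = ∑-cong (allFin n) λ i → ∑-cong (allFin n) λ j → *-identityʳ (W i j)

    -- With `K = 2 ^ m` there are `n` choices for each of `i` and `j`, `n ^ K` for `X` and at most
    -- `D * n` for `Y`. The factor `n ^ K` from `totalWalks-power` brings the exponent of `n` to
    -- `2 * K + 3`, and cancelling one `n` leaves `2 * K + 2`.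
    energy-power-≤ : 1 ≤ n → ∀ m D → (∀ M → M ∈ prods n (2 ^ m) → (∑ (prods n (2 ^ m)) λ Y → 𝟙 (Y ≟ M)) ≤ D * n) →
      energy ^ (2 ^ m) ≤ D * n ^ (2 + 2 * 2 ^ m)
    energy-power-≤ 1≤n m D bound = *-cancelʳ-≤ _ _ n {{>-nonZero 1≤n}} (begin
      energy ^ K * n                    ≤⟨ totalWalks-power 1≤n m ⟩
      n ^ K * totalWalks K              ≤⟨ *-monoʳ-≤ (n ^ K) total ⟩
      n ^ K * (n * (n * (n ^ K * (D * n))))  ≡⟨ collect (n ^ K) n D ⟩
      D * (n * (n * (n ^ K * n ^ K))) * n   ≡⟨ cong (λ t → D * (n * (n * t)) * n) (sym double) ⟩
      D * n ^ (2 + 2 * K) * n           ∎)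
      where
      K : ℕ
      K = 2 ^ m
      total : totalWalks K ≤ n * (n * (n ^ K * (D * n)))
      total = ∑-allFin-≤ n λ i → ≤-trans (walks-≤-G K i)
        (∑-allFin-≤ n λ j → solutions-≤ {n} {K} {D * n} bound (a i) (a j) (1≤a i))
      double : n ^ (2 * K) ≡ n ^ K * n ^ K
      double = trans (cong (λ t → n ^ (K + t)) (+-identityʳ K)) (^-distribˡ-+-* n K K)
      collect : ∀ N n D → N * (n * (n * (N * (D * n)))) ≡ D * (n * (n * (N * N))) * n
      collect = solve-∀

  -- From greatest common divisors to pair counts.

  multipleCount : ℕ → ℕ → ℕ
  multipleCount v n = ∑ (range n) λ y → 𝟙 (v ∣? y)

  -- Here `multipleCount v n` is `⌊n / v⌋`. When `suc n` is a multiple of `v`, the right side grows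
  -- by `v ≥ 1`; otherwise `suc n` cannot reach the right side, which is a multiple of `v`.
  n<[1+multipleCount]*v : ∀ v → 1 ≤ v → ∀ n → n < suc (multipleCount v n) * v
  n<[1+multipleCount]*v v 1≤v zero    = ≤-trans 1≤v (m≤m+n v 0)
  n<[1+multipleCount]*v v 1≤v (suc n) with v ∣? suc n
  ... | yes _  = +-mono-≤ 1≤v (n<[1+multipleCount]*v v 1≤v n)
  ... | no v∤ = ≤∧≢⇒< (n<[1+multipleCount]*v v 1≤v n) λ eq → v∤ (divides (suc (multipleCount v n)) eq)

  module _ {n : ℕ} where

    -- The estimate of `n gcd(a, b) / b` with denominators cleared. For `b = v * g`, it follows from
    -- `n < (1 + ⌊n / v⌋) v`, since each multiple `y` of `v` in the range has a matching `x`.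
    gcd*n≤ : ∀ a b → 1 ≤ a → a ≤ b →
      gcd a b * n ≤ suc (∑ (range n) λ y → ∑ (range n) λ x → 𝟙 (a * y ≟ b * x)) * b
    gcd*n≤ a b 1≤a a≤b with gcd a b | gcd[m,n]∣m a b | gcd[m,n]∣n a b
    ... | g | divides u refl | divides v refl = begin
      g * n                              ≤⟨ *-monoʳ-≤ g (<⇒≤ (n<[1+multipleCount]*v v 1≤v n)) ⟩
      g * (suc (multipleCount v n) * v)  ≡⟨ rotate g (suc (multipleCount v n)) v ⟩
      suc (multipleCount v n) * (v * g)  ≤⟨ *-monoˡ-≤ (v * g) (s≤s (∑-mono (range n) witness)) ⟩
      suc (∑ (range n) λ y → ∑ (range n) λ x → 𝟙 (u * g * y ≟ v * g * x)) * (v * g) ∎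
      where
      rotate : ∀ a b c → a * (b * c) ≡ b * (c * a)
      rotate = solve-∀
      1≤g : 1 ≤ g
      1≤g = n≢0⇒n>0 λ { refl → contradiction (subst (1 ≤_) (*-zeroʳ u) 1≤a) λ () }
      1≤u : 1 ≤ u
      1≤u = n≢0⇒n>0 λ { refl → contradiction 1≤a λ () }
      -- This keeps the matching `x = s * u` below `y = s * v`, hence inside the range.
      u≤v : u ≤ v
      u≤v = *-cancelʳ-≤ u v g {{>-nonZero 1≤g}} a≤b
      1≤v : 1 ≤ v
      1≤v = ≤-trans 1≤u u≤v
      witness : ∀ {y} → y ∈ range n → 𝟙 (v ∣? y) ≤ ∑ (range n) λ x → 𝟙 (u * g * y ≟ v * g * x)
      -- For y = s v the matching x is s u, as g u · s v = g v · s u.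
      witness {y} y∈ = 𝟙-≤ (v ∣? y) λ { (divides s refl) → ≤-trans
          (≤-reflexive (sym (𝟙-true (u * g * (s * v) ≟ v * g * (s * u)) (identity u g s v))))
          (∑-term {f = λ x → 𝟙 (u * g * (s * v) ≟ v * g * x)}
            (∈-range⁺ (*-mono-≤ {1} {s} {1} {u} (n≢0⇒n>0 λ { refl → contradiction (proj₁ (∈-range⁻ y∈)) λ () }) 1≤u)
                      (≤-trans (*-monoʳ-≤ s u≤v) (proj₂ (∈-range⁻ y∈))))) }
        where
        identity : ∀ u g s v → u * g * (s * v) ≡ v * g * (s * u)
        identity = solve-∀

  -- The sum is at most twice the maximum, and the maximum is one of `x` and `y`.
  +-^-≤ : ∀ k {x y B} → x ^ k ≤ B → y ^ k ≤ B → (x + y) ^ k ≤ 2 ^ k * B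
  +-^-≤ k {x} {y} {B} xᵏ≤B yᵏ≤B = begin
    (x + y) ^ k            ≤⟨ ^-monoˡ-≤ k (+-mono-≤ (m≤m⊔n x y) (m≤n⊔m x y)) ⟩
    (x ⊔ y + (x ⊔ y)) ^ k  ≡⟨ cong (λ t → (x ⊔ y + t) ^ k) (sym (+-identityʳ (x ⊔ y))) ⟩
    (2 * (x ⊔ y)) ^ k      ≡⟨ ^-distribʳ-* k 2 (x ⊔ y) ⟩
    2 ^ k * (x ⊔ y) ^ k    ≤⟨ *-monoʳ-≤ (2 ^ k) max ⟩
    2 ^ k * B              ∎
    where
    max : (x ⊔ y) ^ k ≤ B
    max with ≤-total x y
    ... | inj₁ x≤y = subst (λ t → t ^ k ≤ B) (sym (m≤n⇒m⊔n≡n x≤y)) yᵏ≤B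
    ... | inj₂ y≤x = subst (λ t → t ^ k ≤ B) (sym (m≥n⇒m⊔n≡m y≤x)) xᵏ≤B

  -- The `q`-th power of the hypothesis is compared with a `k`-th power. The excess 2 in the
  -- exponent `2 + 2 * k` becomes `2 * q ≤ k`, which costs a single factor `n` after the `k`-th
  -- root; the constant uses `C ≤ C ^ k`.
  root-≤ : ∀ {q k C n R} .{{_ : NonZero k}} → 1 ≤ n → 1 ≤ C → 2 * q ≤ k →
    R ^ k ≤ 2 ^ k * (C * n ^ (2 + 2 * k)) → R ^ q ≤ (2 * C) ^ q * n ^ (1 + 2 * q)
  root-≤ {q} {k} {C} {n} {R} 1≤n 1≤C 2q≤k Rᵏ≤ = ^-cancelʳ-≤ k (begin
    (R ^ q) ^ k                               ≡⟨ ^-swap R q k ⟩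
    (R ^ k) ^ q                               ≤⟨ ^-monoˡ-≤ q Rᵏ≤ ⟩
    (2 ^ k * (C * n ^ (2 + 2 * k))) ^ q
      ≤⟨ ^-monoˡ-≤ q (*-monoʳ-≤ (2 ^ k) (*-monoˡ-≤ (n ^ (2 + 2 * k)) (m≤m^n C k {{>-nonZero 1≤C}}))) ⟩
    (2 ^ k * (C ^ k * n ^ (2 + 2 * k))) ^ q
      ≡⟨ cong (_^ q) (trans (sym (*-assoc (2 ^ k) _ _)) (cong (_* n ^ (2 + 2 * k)) (sym (^-distribʳ-* k 2 C)))) ⟩
    ((2 * C) ^ k * n ^ (2 + 2 * k)) ^ q       ≡⟨ ^-distribʳ-* q ((2 * C) ^ k) _ ⟩
    ((2 * C) ^ k) ^ q * (n ^ (2 + 2 * k)) ^ q ≡⟨ cong₂ _*_ (^-swap (2 * C) k q) (^-*-assoc n (2 + 2 * k) q) ⟩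
    ((2 * C) ^ q) ^ k * n ^ ((2 + 2 * k) * q) ≤⟨ *-monoʳ-≤ (((2 * C) ^ q) ^ k) (^-monoʳ-≤ n {{>-nonZero 1≤n}} exponent) ⟩
    ((2 * C) ^ q) ^ k * n ^ ((1 + 2 * q) * k) ≡⟨ cong (((2 * C) ^ q) ^ k *_) (sym (^-*-assoc n (1 + 2 * q) k)) ⟩
    ((2 * C) ^ q) ^ k * (n ^ (1 + 2 * q)) ^ k ≡⟨ ^-distribʳ-* k ((2 * C) ^ q) _ ⟨
    ((2 * C) ^ q * n ^ (1 + 2 * q)) ^ k       ∎)
    where
    exponent : (2 + 2 * k) * q ≤ (1 + 2 * q) * k
    exponent = begin
      (2 + 2 * k) * q      ≡⟨ lhs k q ⟩
      2 * q + 2 * q * k    ≤⟨ +-monoˡ-≤ (2 * q * k) 2q≤k ⟩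
      (1 + 2 * q) * k      ∎
      where
      lhs : ∀ k q → (2 + 2 * k) * q ≡ 2 * q + 2 * q * k
      lhs = solve-∀

  -- The summand `n * n` accounts for the 1 in `1 + W i j`, summed over all pairs.
  energyBound : ∀ q → ∃ λ D → ∀ {n} → 1 ≤ n → (a : Fin n → ℕ) (1≤a : ∀ i → 1 ≤ a i)
    (a-inj : ∀ {i j} → a i ≡ a j → i ≡ j) →
    (n * n + GCDMatrix.energy a 1≤a a-inj) ^ q ≤ D ^ q * n ^ (1 + 2 * q)
  -- The exponent is a power of two for the iterated Cauchy-Schwarz inequality, and at least `2 * q`
  -- for `root-≤`.
  energyBound q with representationBound (2 ^ (2 * q)) {{m^n≢0 2 (2 * q)}}
  ... | C , 1≤C , bound = 2 * C , λ {n} 1≤n a 1≤a a-inj →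
    root-≤ {q} {k} {C} {n} {{m^n≢0 2 (2 * q)}} 1≤n 1≤C (<⇒≤ (n<2^n (2 * q)))
      (+-^-≤ k (diagonal n 1≤n)
        (GCDMatrix.energy-power-≤ a 1≤a a-inj 1≤n (2 * q) C (bound n)))
    where
    k : ℕ
    k = 2 ^ (2 * q)
    -- The same bound as for the `k`-th power of the energy, so that `+-^-≤` applies to the sum.
    diagonal : ∀ n → 1 ≤ n → (n * n) ^ k ≤ C * n ^ (2 + 2 * k)
    diagonal n 1≤n = begin
      (n * n) ^ k            ≡⟨ cong (λ t → (n * t) ^ k) (sym (*-identityʳ n)) ⟩
      (n ^ 2) ^ k            ≡⟨ ^-*-assoc n 2 k ⟩
      n ^ (2 * k)            ≤⟨ ^-monoʳ-≤ n {{>-nonZero 1≤n}} (m≤n+m (2 * k) 2) ⟩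
      n ^ (2 + 2 * k)        ≤⟨ m≤n*m (n ^ (2 + 2 * k)) C {{>-nonZero 1≤C}} ⟩
      C * n ^ (2 + 2 * k)    ∎

open Energy

-- Passage between natural and rational numbers.

module Rationals where
  open import Data.Integer using (+_)
  open import Data.Nat using (_*_; _<_)

  ι : ℕ → ℚ
  ι m = + m ℚ./ 1

  -- Rationals are kept in lowest terms, so facts about `ι` are checked by cross-multiplication of
  -- unnormalised fractions.
  toℚᵘ-ι : ∀ m → toℚᵘ (ι m) ℚᵘ.≃ ℚᵘ.mkℚᵘ (+ m) 0
  toℚᵘ-ι m = ℚ.toℚᵘ-fromℚᵘ (ℚᵘ.mkℚᵘ (+ m) 0)

  ι-+ : ∀ m n → ι (m + n) ≡ ι m ℚ.+ ι n
  ι-+ m n = ℚ.toℚᵘ-injective (begin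
    toℚᵘ (ι (m + n))                           ≈⟨ toℚᵘ-ι (m + n) ⟩
    ℚᵘ.mkℚᵘ (+ (m + n)) 0                      ≈⟨ ℚᵘ.*≡* (cong (ℤ._* + 1) (cong₂ ℤ._+_ (sym (ℤ.*-identityʳ (+ m))) (sym (ℤ.*-identityʳ (+ n))))) ⟩
    ℚᵘ.mkℚᵘ (+ m) 0 ℚᵘ.+ ℚᵘ.mkℚᵘ (+ n) 0       ≈⟨ ℚᵘ.+-cong (toℚᵘ-ι m) (toℚᵘ-ι n) ⟨
    toℚᵘ (ι m) ℚᵘ.+ toℚᵘ (ι n)                 ≈⟨ ℚ.toℚᵘ-homo-+ (ι m) (ι n) ⟨
    toℚᵘ (ι m ℚ.+ ι n)                         ∎)
    where open ℚᵘ.≃-Reasoning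

  ι-* : ∀ m n → ι (m * n) ≡ ι m ℚ.* ι n
  ι-* m n = ℚ.toℚᵘ-injective (begin
    toℚᵘ (ι (m * n))                           ≈⟨ toℚᵘ-ι (m * n) ⟩
    ℚᵘ.mkℚᵘ (+ (m * n)) 0                      ≈⟨ ℚᵘ.*≡* (cong (ℤ._* + 1) (ℤ.pos-* m n)) ⟩
    ℚᵘ.mkℚᵘ (+ m) 0 ℚᵘ.* ℚᵘ.mkℚᵘ (+ n) 0       ≈⟨ ℚᵘ.*-cong (toℚᵘ-ι m) (toℚᵘ-ι n) ⟨
    toℚᵘ (ι m) ℚᵘ.* toℚᵘ (ι n)                 ≈⟨ ℚ.toℚᵘ-homo-* (ι m) (ι n) ⟨
    toℚᵘ (ι m ℚ.* ι n)                         ∎)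
    where open ℚᵘ.≃-Reasoning

  frac*ι≤ι : ∀ x y n h → 1 ≤ y → x * n ≤ h * y → frac x y ℚ.* ι n ℚ.≤ ι h
  frac*ι≤ι x (suc y) n h _ x*n≤ = ℚ.toℚᵘ-cancel-≤ (begin
    toℚᵘ (frac x (suc y) ℚ.* ι n)              ≃⟨ ℚ.toℚᵘ-homo-* (frac x (suc y)) (ι n) ⟩
    toℚᵘ (frac x (suc y)) ℚᵘ.* toℚᵘ (ι n)      ≃⟨ ℚᵘ.*-cong (ℚ.toℚᵘ-fromℚᵘ (ℚᵘ.mkℚᵘ (+ x) y)) (toℚᵘ-ι n) ⟩
    ℚᵘ.mkℚᵘ (+ x) y ℚᵘ.* ℚᵘ.mkℚᵘ (+ n) 0       ≤⟨ ℚᵘ.*≤* cross ⟩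
    ℚᵘ.mkℚᵘ (+ h) 0                            ≃⟨ toℚᵘ-ι h ⟨
    toℚᵘ (ι h)                                 ∎)
    where
    open ℚᵘ.≤-Reasoning
    cross : (+ x ℤ.* + n) ℤ.* + 1 ℤ.≤ + h ℤ.* + (suc y * 1)
    cross = subst₂ ℤ._≤_ (trans (ℤ.pos-* x n) (sym (ℤ.*-identityʳ _)))
      (trans (ℤ.pos-* h (suc y)) (cong (λ t → + h ℤ.* + t) (sym (*-identityʳ (suc y)))))
      (ℤ.+≤+ x*n≤)

  ι-mono-≤ : ∀ {m n} → m ≤ n → ι m ℚ.≤ ι n
  ι-mono-≤ {m} {n} m≤n = ℚ.toℚᵘ-cancel-≤ (begin
    toℚᵘ (ι m)        ≃⟨ toℚᵘ-ι m ⟩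
    ℚᵘ.mkℚᵘ (+ m) 0   ≤⟨ ℚᵘ.*≤* (ℤ.*-monoʳ-≤-nonNeg (+ 1) (ℤ.+≤+ m≤n)) ⟩
    ℚᵘ.mkℚᵘ (+ n) 0   ≃⟨ toℚᵘ-ι n ⟨
    toℚᵘ (ι n)        ∎)
    where open ℚᵘ.≤-Reasoning

  ι-mono-< : ∀ {m n} → m < n → ι m ℚ.< ι n
  ι-mono-< {m} {n} m<n = ℚ.toℚᵘ-cancel-< (begin-strict
    toℚᵘ (ι m)        ≃⟨ toℚᵘ-ι m ⟩
    ℚᵘ.mkℚᵘ (+ m) 0   <⟨ ℚᵘ.*<* (ℤ.*-monoʳ-<-pos (+ 1) (ℤ.+<+ m<n)) ⟩
    ℚᵘ.mkℚᵘ (+ n) 0   ≃⟨ toℚᵘ-ι n ⟨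
    toℚᵘ (ι n)        ∎)
    where open ℚᵘ.≤-Reasoning

  ι-^ : ∀ m k → ι (m ^ k) ≡ ι m ^ℚ k
  ι-^ m zero    = refl
  ι-^ m (suc k) = trans (ι-* m (m ^ k)) (cong (ι m ℚ.*_) (ι-^ m k))

  *-^ℚ : ∀ k x y → (x ℚ.* y) ^ℚ k ≡ (x ^ℚ k) ℚ.* (y ^ℚ k)
  *-^ℚ zero    x y = refl
  *-^ℚ (suc k) x y = trans (cong (x ℚ.* y ℚ.*_) (*-^ℚ k x y)) (interchange x y (x ^ℚ k) (y ^ℚ k))
    where
    open import Algebra.Properties.CommutativeSemigroup
      (CommutativeMonoid.commutativeSemigroup ℚ.*-1-commutativeMonoid) using (interchange)

  ^ℚ-nonNeg : ∀ k {x} → 0ℚ ℚ.≤ x → 0ℚ ℚ.≤ x ^ℚ k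
  ^ℚ-nonNeg zero    _   = ι-mono-≤ {0} {1} z≤n
  ^ℚ-nonNeg (suc k) {x} 0≤x = ℚ.nonNegative⁻¹ _
    {{ℚ.nonNeg*nonNeg⇒nonNeg x {{ℚ.nonNegative 0≤x}} (x ^ℚ k) {{ℚ.nonNegative (^ℚ-nonNeg k 0≤x)}}}}

  ^ℚ-mono-≤ : ∀ k {x y} → 0ℚ ℚ.≤ x → x ℚ.≤ y → x ^ℚ k ℚ.≤ y ^ℚ k
  ^ℚ-mono-≤ zero    _   _   = ℚ.≤-refl
  ^ℚ-mono-≤ (suc k) {x} {y} 0≤x x≤y = ℚ.≤-trans
    (ℚ.*-monoʳ-≤-nonNeg (x ^ℚ k) {{ℚ.nonNegative (^ℚ-nonNeg k 0≤x)}} x≤y)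
    (ℚ.*-monoˡ-≤-nonNeg y {{ℚ.nonNegative (ℚ.≤-trans 0≤x x≤y)}} (^ℚ-mono-≤ k 0≤x x≤y))

  frac-nonNeg : ∀ x y → 0ℚ ℚ.≤ frac x y
  frac-nonNeg x zero    = ℚ.≤-refl
  frac-nonNeg x (suc y) = ℚ.nonNegative⁻¹ _ {{ℚ.normalize-nonNeg x (suc y)}}

  module _ {A : Set} where
    sumℚ-nonNeg : ∀ (xs : List A) {f} → (∀ x → 0ℚ ℚ.≤ f x) → 0ℚ ℚ.≤ sumℚ (map f xs)
    sumℚ-nonNeg []       h = ℚ.≤-refl
    sumℚ-nonNeg (x ∷ xs) h = ℚ.+-mono-≤ (h x) (sumℚ-nonNeg xs h)

    -- Scaling by `ι n` gives each summand the form bounded by `gcd*n≤`, which reduces the rational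
    -- sum to a sum of natural numbers.
    sumℚ*ι≤ι∑ : ∀ n (xs : List A) {f h} → (∀ {x} → x ∈ xs → f x ℚ.* ι n ℚ.≤ ι (h x)) →
      sumℚ (map f xs) ℚ.* ι n ℚ.≤ ι (∑ xs h)
    sumℚ*ι≤ι∑ n []       _ = ℚ.≤-reflexive (ℚ.*-zeroˡ (ι n))
    sumℚ*ι≤ι∑ n (x ∷ xs) {f} {h} f≤h = begin
      (f x ℚ.+ sumℚ (map f xs)) ℚ.* ι n               ≡⟨ ℚ.*-distribʳ-+ (ι n) (f x) _ ⟩
      f x ℚ.* ι n ℚ.+ sumℚ (map f xs) ℚ.* ι n         ≤⟨ ℚ.+-mono-≤ (f≤h (here refl)) (sumℚ*ι≤ι∑ n xs (f≤h ∘ there)) ⟩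
      ι (h x) ℚ.+ ι (∑ xs h)                          ≡⟨ ι-+ (h x) (∑ xs h) ⟨
      ι (∑ (x ∷ xs) h)                                ∎
      where open ℚ.≤-Reasoning

  gcdSum-nonNeg : ∀ n a → 0ℚ ℚ.≤ gcdSum n a
  gcdSum-nonNeg n a = sumℚ-nonNeg (allFin n) λ j → sumℚ-nonNeg (filter (F._<? j) (allFin n)) λ i → frac-nonNeg _ (a j)

  strictlyIncreasing⇒injective : ∀ {n} (a : Fin n → ℕ) → (∀ i j → i F.< j → a i < a j) → ∀ {i j} → a i ≡ a j → i ≡ j
  strictlyIncreasing⇒injective a a-< {i} {j} aᵢ≡aⱼ with F.<-cmp i j
  ... | tri< i<j _ _ = contradiction aᵢ≡aⱼ (<⇒≢ (a-< i j i<j))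

  ... | tri≈ _ i≡j _ = i≡j
  ... | tri> _ _ j<i = contradiction (sym aᵢ≡aⱼ) (<⇒≢ (a-< j i j<i))

  module _ {n : ℕ} (a : Fin n → ℕ) (1≤a : ∀ i → 1 ≤ a i) (a-< : ∀ i j → i F.< j → a i < a j) where
    private
      a-inj : ∀ {i j} → a i ≡ a j → i ≡ j
      a-inj = strictlyIncreasing⇒injective a a-<

    open GCDMatrix a 1≤a a-inj

    -- Each scaled summand is at most `1 + W i j`. Extending the sum from `i < j` to all pairs, the
    -- ones add up to `n * n` and the rest to the energy.
    gcdSum*ι≤ : gcdSum n a ℚ.* ι n ℚ.≤ ι (n * n + energy)
    gcdSum*ι≤ = ℚ.≤-trans
      (sumℚ*ι≤ι∑ n (allFin n) λ {j} _ → sumℚ*ι≤ι∑ n (filter (F._<? j) (allFin n)) λ {i} i∈ →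
        term i j (proj₂ (∈-filter⁻ (F._<? j) {xs = allFin n} i∈)))
      (ι-mono-≤ (begin
        (∑ (allFin n) λ j → ∑ (filter (F._<? j) (allFin n)) λ i → suc (W i j))
          ≤⟨ ∑-mono (allFin n) (λ {j} _ → ∑-filter-≤ (F._<? j) (allFin n) _) ⟩
        (∑ (allFin n) λ j → ∑ (allFin n) λ i → 1 + W i j)
          ≡⟨ ∑-cong (allFin n) (λ j → trans (∑-+ (allFin n) _ _)
               (cong (_+ ∑ (allFin n) λ i → W i j) (trans (∑-const (allFin n) 1) (trans (*-identityʳ _) (length-allFin n))))) ⟩
        (∑ (allFin n) λ j → n + ∑ (allFin n) λ i → W i j)
          ≡⟨ ∑-+ (allFin n) _ _ ⟩
        (∑ (allFin n) λ j → n) + (∑ (allFin n) λ j → ∑ (allFin n) λ i → W i j)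
          ≡⟨ cong₂ _+_ (trans (∑-const (allFin n) n) (cong (_* n) (length-allFin n)))
               (trans (∑-swap (allFin n) (allFin n) _) (sym energy≡)) ⟩
        n * n + energy
          ∎))
      where
      open ≤-Reasoning
      term : ∀ i j → i F.< j → frac (gcd (a i) (a j)) (a j) ℚ.* ι n ℚ.≤ ι (suc (W i j))
      term i j i<j = frac*ι≤ι (gcd (a i) (a j)) (a j) n (suc (W i j)) (1≤a j)
        (gcd*n≤ (a i) (a j) (1≤a i) (<⇒≤ (a-< i j i<j)))

  -- Dividing by `n ^ q` lowers the exponent `1 + 2 * q` to `q + 1`, which is at most `q + p`.
  -- Strictness comes from replacing `D` by `suc D`.
  power-<-from-scaled : ∀ {S n R D} q p .{{_ : NonZero q}} → 1 ≤ p → 1 ≤ n →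
    0ℚ ℚ.≤ S → S ℚ.* ι n ℚ.≤ ι R → R ^ q ≤ D ^ q * n ^ (1 + 2 * q) →
    S ^ℚ q ℚ.< (ι (suc D) ^ℚ q) ℚ.* ι (n ^ (q + p))
  power-<-from-scaled {S} {n} {R} {D} q p 1≤p 1≤n 0≤S Sn≤R R^q≤ = begin-strict
    S ^ℚ q                             ≤⟨ ℚ.*-cancelʳ-≤-pos (ι (n ^ q)) {{ℚ.positive (ι-mono-< (m^n>0 n {{n≢0}} q))}} scaled ⟩
    ι (D ^ q * n ^ (q + 1))            <⟨ ι-mono-< (<-≤-trans
                                           (*-monoˡ-< (n ^ (q + 1)) {{m^n≢0 n (q + 1) {{n≢0}}}} (^-monoˡ-< q (n<1+n D)))
                                           (*-monoʳ-≤ (suc D ^ q) (^-monoʳ-≤ n {{n≢0}} (+-monoʳ-≤ q 1≤p)))) ⟩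
    ι (suc D ^ q * n ^ (q + p))        ≡⟨ ι-* (suc D ^ q) _ ⟩
    ι (suc D ^ q) ℚ.* ι (n ^ (q + p))  ≡⟨ cong (ℚ._* ι (n ^ (q + p))) (ι-^ (suc D) q) ⟩
    (ι (suc D) ^ℚ q) ℚ.* ι (n ^ (q + p)) ∎
    where
    open ℚ.≤-Reasoning
    n≢0 : NonZero n
    n≢0 = >-nonZero 1≤n
    exponent : ∀ q → 1 + 2 * q ≡ q + 1 + q
    exponent = solve-∀
    scaled : (S ^ℚ q) ℚ.* ι (n ^ q) ℚ.≤ ι (D ^ q * n ^ (q + 1)) ℚ.* ι (n ^ q)
    scaled = begin
      (S ^ℚ q) ℚ.* ι (n ^ q)                  ≡⟨ cong ((S ^ℚ q) ℚ.*_) (ι-^ n q) ⟩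
      (S ^ℚ q) ℚ.* (ι n ^ℚ q)                 ≡⟨ *-^ℚ q S (ι n) ⟨
      (S ℚ.* ι n) ^ℚ q                        ≤⟨ ^ℚ-mono-≤ q 0≤Sn Sn≤R ⟩
      ι R ^ℚ q                                ≡⟨ ι-^ R q ⟨
      ι (R ^ q)                               ≤⟨ ι-mono-≤ R^q≤ ⟩
      ι (D ^ q * n ^ (1 + 2 * q))             ≡⟨ cong (λ t → ι (D ^ q * t)) (trans (cong (n ^_) (exponent q)) (^-distribˡ-+-* n (q + 1) q)) ⟩
      ι (D ^ q * (n ^ (q + 1) * n ^ q))       ≡⟨ cong ι (sym (*-assoc (D ^ q) _ _)) ⟩
      ι (D ^ q * n ^ (q + 1) * n ^ q)         ≡⟨ ι-* (D ^ q * n ^ (q + 1)) (n ^ q) ⟩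
      ι (D ^ q * n ^ (q + 1)) ℚ.* ι (n ^ q)   ∎
      where
      0≤Sn : 0ℚ ℚ.≤ S ℚ.* ι n
      0≤Sn = ℚ.nonNegative⁻¹ _ {{ℚ.nonNeg*nonNeg⇒nonNeg S {{ℚ.nonNegative 0≤S}} (ι n) {{ℚ.nonNegative (ι-mono-≤ {0} {n} z≤n)}}}}

open Rationals

-- The bound for `ε = p / q`.

open import Data.Integer using (+_)
open import Data.Rational using (_<_; _*_; _/_)

-- Taking `q`-th powers turns `n^(1 + ε)` with `ε = p / q` into the natural number `n ^ (q + p)`;
-- every positive real exponent exceeds such an `ε`. The constant `c = D + 1` is determined by `q`
-- alone.
theorem2 : (p q : ℕ) → 1 ≤ p → 1 ≤ q →
    ∃ λ (c : ℚ) → (0ℚ < c) ×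
    ((n : ℕ) → 1 ≤ n → (a : Fin n → ℕ) →
    (∀ i → 1 ≤ a i) →
    (∀ i j → i F.< j → a i N.< a j) →
    (gcdSum n a ^ℚ q) < ((c ^ℚ q) * ((+ (n ^ (q + p))) / 1)))
theorem2 p q 1≤p 1≤q with energyBound q
... | D , bound = ι (suc D) , ι-mono-< {0} {suc D} (s≤s z≤n) , λ n 1≤n a 1≤a a-< →
  power-<-from-scaled {D = D} q p {{>-nonZero 1≤q}} 1≤p 1≤n (gcdSum-nonNeg n a) (gcdSum*ι≤ a 1≤a a-<)
    (bound 1≤n a 1≤a (strictlyIncreasing⇒injective a a-<))
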